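{- Let $G=(V,E)$ be a finite undirected graph. For every function $d : V \to \mathbb{N}$, the pair $(E,\mathcal{I})$ with $$\mathcal{I} := \{A \subseteq E : \deg_A(v) \leq d(v) \text{ for all } v \in V\}, \qquad \deg_A(v) := |\{w : \{v,w\} \in A\}|,$$ is a $2$-independence system.
   Context: A $p$-independence system is a pair $(E,\mathcal{I})$ with $\mathcal{I} \subseteq 2^E$ nonempty (members are called independent sets) such that: (i) for all $A \subset B \subseteq E$, if $B \in \mathcal{I}$ then $A \in \mathcal{I}$; (ii) for $C \subseteq E$ let $\mathcal{B}(C) := \{B \subseteq C : B \in \mathcal{I} \text{ and } B \cup \{e\} \notin \mathcal{I} \text{ for all } e \in C \setminus B\}$ be the set of maximal independent subsets of $C$; then for all nonempty $C \subseteq E$, $\max_{B \in \mathcal{B}(C)} |B| \leq p \cdot \min_{B \in \mathcal{B}(C)} |B|$. Graphs are simple: edges are two-element subsets $\{u,v\}$ of $V$. -}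

module Defs where

open import Data.Bool.Properties using (_≟_)
open import Data.Fin.Base using (Fin)
open import Data.Fin.Properties using (any?)
open import Data.Fin.Subset using (Subset; _∈_; _⊆_; _⊂_; _∪_; _─_; ⁅_⁆; ∣_∣; Nonempty)
open import Data.Fin.Subset.Properties using (_∈?_)
open import Data.Nat.Base using (ℕ; _*_; _≤_)
open import Data.Product.Base using (∃; ∃₂; _×_)
open import Data.Vec.Base using (tabulate)
open import Data.Vec.Properties using (≡-dec)
open import Function.Definitions using (Injective)
open import Level using (0ℓ)
open import Relation.Binary.PropositionalEquality.Core using (_≡_)
open import Relation.Nullary.Decidable.Core using (Dec; does; _×-dec_)
open import Relation.Nullary.Negation.Core using (¬_)
open import Relation.Unary using (Pred; Satisfiable)

IsMaxSize : ∀ {m} → Pred (Subset m) 0ℓ → ℕ → Set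
IsMaxSize P k = (∃ λ B → P B × ∣ B ∣ ≡ k) × (∀ B → P B → ∣ B ∣ ≤ k)

IsMinSize : ∀ {m} → Pred (Subset m) 0ℓ → ℕ → Set
IsMinSize P k = (∃ λ B → P B × ∣ B ∣ ≡ k) × (∀ B → P B → k ≤ ∣ B ∣)

-- The ground set is Fin m; the family of independent sets is a predicate on
-- its subsets.

record MaximalIndependentIn {m : ℕ} (I : Pred (Subset m) 0ℓ)
                            (C B : Subset m) : Set where
  field
    within      : B ⊆ C
    independent : I B
    maximal     : ∀ e → e ∈ C ─ B → ¬ I (B ∪ ⁅ e ⁆)

-- The last field asserts that the maximum and the minimum are attained, so
-- that the inequality between them can never hold vacuously.

record IsIndependenceSystem (p : ℕ) {m : ℕ} (I : Pred (Subset m) 0ℓ) : Set where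
  field
    nonempty   : Satisfiable I
    hereditary : ∀ A B → A ⊂ B → I B → I A
    max≤p*min  : ∀ C → Nonempty C → ∃₂ λ max min →
                   IsMaxSize (MaximalIndependentIn I C) max ×
                   IsMinSize (MaximalIndependentIn I C) min ×
                   max ≤ p * min

-- The vertices are Fin #V.  The edge set is a set of two-element subsets of
-- the vertex set, listed without repetition by Fin #E, so that Subset #E is
-- the type of sets of edges.

record Graph : Set where
  field
    #V             : ℕ
    #E             : ℕ
    edge           : Fin #E → Subset #V
    edge-size      : ∀ e → ∣ edge e ∣ ≡ 2
    edge-injective : Injective _≡_ _≡_ edge

module _ (G : Graph) where
  open Graph G

  -- {v , w} ∈ A; impossible for v ≡ w, because of edge-size.
  Joined : Subset #E → Fin #V → Fin #V → Set
  Joined A v w = ∃ λ e → e ∈ A × edge e ≡ ⁅ v ⁆ ∪ ⁅ w ⁆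

  joined? : ∀ A v w → Dec (Joined A v w)
  joined? A v w = any? λ e → (e ∈? A) ×-dec ≡-dec _≟_ (edge e) (⁅ v ⁆ ∪ ⁅ w ⁆)

  neighbours : Subset #E → Fin #V → Subset #V
  neighbours A v = tabulate λ w → does (joined? A v w)

  deg : Subset #E → Fin #V → ℕ
  deg A v = ∣ neighbours A v ∣

  DegreeBounded : (Fin #V → ℕ) → Pred (Subset #E) 0ℓ
  DegreeBounded d A = ∀ v → deg A v ≤ d v

{-# OPTIONS --safe #-}

-- Let B be maximal independent in C, let A ⊆ C be independent, and call a
-- vertex v saturated when d v ≤ deg B v.  Let s e ∈ {0 , 1 , 2} be the number
-- of saturated endpoints of e.  Maximality gives 1 ≤ s e for e ∈ A ─ B, hence
-- for every edge
--
--   [e ∈ A] + [e ∈ B] s e ≤ 2 [e ∈ B] + [e ∈ A] s e.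
--
-- Summing over e, and using that ∑ [e ∈ A] s e is the sum of deg A over the
-- saturated vertices, where deg A v ≤ d v ≤ deg B v, yields ∣ A ∣ ≤ 2 ∣ B ∣.

module Submission where

open import Defs
open import Data.Bool.Base using (if_then_else_)
open import Data.Bool.Properties using () renaming (_≟_ to _≟ᵇ_)
open import Data.Fin.Base using (Fin; zero; suc)
open import Data.Fin.Properties using (any?; all?; ¬∀⟶∃¬; suc-injective)
open import Data.Fin.Subset
  using (Subset; inside; outside; _∈_; _∉_; _⊆_; _⊂_; _∪_; _─_; ∁; ⊥; ⁅_⁆; ∣_∣)
open import Data.Fin.Subset.Properties
  using (_∈?_; _⊆?_; anySubset?; ∣⊥∣≡0; ⊥⊆; ∪-idem; ∪-identityˡ; ∪-identityʳ;
         x∈⁅x⁆; x∈⁅y⁆⇒x≡y; ∣⁅x⁆∣≡1; x∈p∪q⁺; x∈p∪q⁻; p⊆p∪q; q⊆p∪q; p─q⊆p;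
         x∈p∧x∉q⇒x∈p─q; p⊂q⇒∣p∣<∣q∣; p⊂q⇒p⊆q; ∣∁p∣≡n∸∣p∣; ∣p∣≤n)
open import Data.Nat.Base using (ℕ; suc; pred; _+_; _*_; _≤_; _<_; z≤n; s≤s; s≤s⁻¹)
open import Data.Nat.Induction using (<-wellFounded)
open import Data.Nat.Properties hiding (suc-injective)
open import Data.Product.Base using (∃; ∃₂; _×_; _,_; proj₁; proj₂)
open import Data.Sum.Base using (inj₁; inj₂; [_,_]′)
open import Data.Vec.Base using (_∷_; []; tabulate; here; there)
open import Data.Vec.Properties using (≡-dec)
open import Function.Base using (_∘_; id)
open import Induction.WellFounded using (Acc; acc)
open import Level using (0ℓ)
open import Relation.Binary.PropositionalEquality
open import Relation.Nullary.Decidable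
  using (Dec; yes; no; does; map′; _×-dec_; _→-dec_; ¬?; decidable-stable)
open import Relation.Nullary.Negation using (¬_; contradiction)
open import Relation.Unary using (Pred; Decidable; Satisfiable)
open import Algebra.Properties.Semiring.Sum +-*-semiring
  using (sum; sum-syntax; sum-cong-≗; ∑-distrib-+; ∑-comm;
         *-distribˡ-sum; *-distribʳ-sum)

-- Sums and indicators

sum-mono-≤ : ∀ {n} {f g : Fin n → ℕ} → (∀ i → f i ≤ g i) → sum f ≤ sum g
sum-mono-≤ {0}     f≤g = z≤n
sum-mono-≤ {suc n} f≤g = +-mono-≤ (f≤g zero) (sum-mono-≤ (f≤g ∘ suc))

term≤sum : ∀ {n} (f : Fin n → ℕ) i → f i ≤ sum f
term≤sum f zero    = m≤m+n _ _
term≤sum f (suc i) = ≤-trans (term≤sum (f ∘ suc) i) (m≤n+m _ _)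

𝟙 : {P : Set} → Dec P → ℕ
𝟙 P? = if does P? then 1 else 0

𝟙≤1 : {P : Set} (P? : Dec P) → 𝟙 P? ≤ 1
𝟙≤1 (yes _) = ≤-refl
𝟙≤1 (no _)  = z≤n

𝟙-true : {P : Set} (P? : Dec P) → P → 𝟙 P? ≡ 1
𝟙-true (yes _) p = refl
𝟙-true (no ¬p) p = contradiction p ¬p

𝟙-false : {P : Set} (P? : Dec P) → ¬ P → 𝟙 P? ≡ 0
𝟙-false (yes p) ¬p = contradiction p ¬p
𝟙-false (no _)  ¬p = refl

𝟙-mono : {P Q : Set} (P? : Dec P) (Q? : Dec Q) → (P → Q) → 𝟙 P? ≤ 𝟙 Q?
𝟙-mono (no _)  Q? P⇒Q = z≤n
𝟙-mono (yes p) Q? P⇒Q = ≤-reflexive (sym (𝟙-true Q? (P⇒Q p)))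

𝟙-cong : {P Q : Set} (P? : Dec P) (Q? : Dec Q) → (P → Q) → (Q → P) → 𝟙 P? ≡ 𝟙 Q?
𝟙-cong P? Q? P⇒Q Q⇒P = ≤-antisym (𝟙-mono P? Q? P⇒Q) (𝟙-mono Q? P? Q⇒P)

𝟙-× : {P Q : Set} (P? : Dec P) (Q? : Dec Q) → 𝟙 (P? ×-dec Q?) ≡ 𝟙 P? * 𝟙 Q?
𝟙-× (no _)  Q? = refl
𝟙-× (yes _) Q? = sym (*-identityˡ (𝟙 Q?))

-- Turns an existential into a sum, so that the double count behind `deg≡∑incident` can exchange the
-- order of summation.
∑𝟙-unique : ∀ {n} {P : Pred (Fin n) 0ℓ} (P? : Decidable P) →
            (∀ {i j} → P i → P j → i ≡ j) → ∑[ i < n ] 𝟙 (P? i) ≡ 𝟙 (any? P?)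
∑𝟙-unique {0}     P? unique = refl
∑𝟙-unique {suc n} P? unique
  rewrite ∑𝟙-unique (P? ∘ suc) (λ p q → suc-injective (unique p q))
  with P? zero
... | no  _ = refl
-- The tail sum has been rewritten as one indicator, and uniqueness makes it vanish once `zero` is
-- the witness.
... | yes p = cong suc (𝟙-false (any? (P? ∘ suc))
                                λ (_ , q) → contradiction (unique p q) λ ())

∣p∣≡∑𝟙 : ∀ {n} (p : Subset n) → ∣ p ∣ ≡ ∑[ i < n ] 𝟙 (i ∈? p)
∣p∣≡∑𝟙 []            = refl
∣p∣≡∑𝟙 (inside  ∷ p) = cong suc (∣p∣≡∑𝟙 p)
∣p∣≡∑𝟙 (outside ∷ p) = ∣p∣≡∑𝟙 p

∣tabulate∣≡∑𝟙 : ∀ {n} {P : Pred (Fin n) 0ℓ} (P? : Decidable P) →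
                ∣ tabulate (does ∘ P?) ∣ ≡ ∑[ i < n ] 𝟙 (P? i)
∣tabulate∣≡∑𝟙 {0}     P? = refl
∣tabulate∣≡∑𝟙 {suc n} P? with P? zero
... | yes _ = cong suc (∣tabulate∣≡∑𝟙 (P? ∘ suc))
... | no  _ = ∣tabulate∣≡∑𝟙 (P? ∘ suc)

-- Two-element subsets

∣p∣≡0⇒p≡⊥ : ∀ {n} (p : Subset n) → ∣ p ∣ ≡ 0 → p ≡ ⊥
∣p∣≡0⇒p≡⊥ []            _  = refl
∣p∣≡0⇒p≡⊥ (outside ∷ p) eq = cong (outside ∷_) (∣p∣≡0⇒p≡⊥ p eq)

∣p∣≡1⇒p≡⁅x⁆ : ∀ {n} (p : Subset n) → ∣ p ∣ ≡ 1 → ∃ λ x → p ≡ ⁅ x ⁆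
∣p∣≡1⇒p≡⁅x⁆ (inside ∷ p) eq =
  zero , cong (inside ∷_) (∣p∣≡0⇒p≡⊥ p (cong pred eq))
∣p∣≡1⇒p≡⁅x⁆ (outside ∷ p) eq =
  let x , p≡⁅x⁆ = ∣p∣≡1⇒p≡⁅x⁆ p eq in suc x , cong (outside ∷_) p≡⁅x⁆

∣p∣≡2⇒p≡⁅x⁆∪⁅y⁆ : ∀ {n} {p : Subset n} {x} → ∣ p ∣ ≡ 2 → x ∈ p →
                   ∃ λ y → p ≡ ⁅ x ⁆ ∪ ⁅ y ⁆
∣p∣≡2⇒p≡⁅x⁆∪⁅y⁆ {p = _ ∷ p} eq here =
  let y , p≡⁅y⁆ = ∣p∣≡1⇒p≡⁅x⁆ p (cong pred eq)
  in suc y , cong (inside ∷_) (trans p≡⁅y⁆ (sym (∪-identityˡ ⁅ y ⁆)))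
∣p∣≡2⇒p≡⁅x⁆∪⁅y⁆ {p = outside ∷ p} eq (there x∈p) =
  let y , p≡ = ∣p∣≡2⇒p≡⁅x⁆∪⁅y⁆ eq x∈p in suc y , cong (outside ∷_) p≡
-- Here `zero` is the other element: the tail is a singleton containing `x`.
∣p∣≡2⇒p≡⁅x⁆∪⁅y⁆ {p = inside ∷ p} eq (there {i = x} x∈p)
  with ∣p∣≡1⇒p≡⁅x⁆ p (cong pred eq)
... | y , refl with refl ← x∈⁅y⁆⇒x≡y y x∈p =
  zero , cong (inside ∷_) (sym (∪-identityʳ ⁅ x ⁆))

-- The element `y` equals `x` or `z`; the size hypothesis excludes `x`, since the union would then
-- be a singleton.
⁅x⁆∪⁅y⁆-injectiveʳ : ∀ {n} {x y z : Fin n} → ∣ ⁅ x ⁆ ∪ ⁅ y ⁆ ∣ ≡ 2 →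
                     ⁅ x ⁆ ∪ ⁅ y ⁆ ≡ ⁅ x ⁆ ∪ ⁅ z ⁆ → y ≡ z
⁅x⁆∪⁅y⁆-injectiveʳ {x = x} {y} {z} size eq
  with x∈p∪q⁻ ⁅ x ⁆ ⁅ z ⁆ (subst (y ∈_) eq (x∈p∪q⁺ (inj₂ (x∈⁅x⁆ y))))
... | inj₂ y∈⁅z⁆ = x∈⁅y⁆⇒x≡y z y∈⁅z⁆
... | inj₁ y∈⁅x⁆ with refl ← x∈⁅y⁆⇒x≡y x y∈⁅x⁆ =
  contradiction (trans (sym size) (trans (cong ∣_∣ (∪-idem ⁅ x ⁆)) (∣⁅x⁆∣≡1 x))) λ ()

-- Independence systems

-- Well-founded descent on `f`: a search through the finitely many subsets either finds a smaller
-- value or certifies that there is none.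
minimiser : ∀ {m} {P : Pred (Subset m) 0ℓ} → Decidable P → Satisfiable P →
            (f : Subset m → ℕ) → ∃ λ B → P B × (∀ B′ → P B′ → f B ≤ f B′)
minimiser {P = P} P? (B₀ , pB₀) f = descend B₀ pB₀ (<-wellFounded (f B₀))
  where
  descend : ∀ B → P B → Acc _<_ (f B) → ∃ λ B → P B × (∀ B′ → P B′ → f B ≤ f B′)
  descend B pB (acc rs) with anySubset? (λ B′ → P? B′ ×-dec (f B′ <? f B))
  ... | yes (B′ , pB′ , fB′<fB) = descend B′ pB′ (rs fB′<fB)
  ... | no  none                = B , pB , λ B′ pB′ → ≮⇒≥ λ lt → none (B′ , pB′ , lt)

-- Lets `minimiser`, applied to the size of the complement, also produce sets of maximum size.
∣∁∣-cancel-≤ : ∀ {m} (p q : Subset m) → ∣ ∁ p ∣ ≤ ∣ ∁ q ∣ → ∣ q ∣ ≤ ∣ p ∣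
∣∁∣-cancel-≤ p q le = ≮⇒≥ λ ∣p∣<∣q∣ → <⇒≱ (∸-monoʳ-< ∣p∣<∣q∣ (∣p∣≤n q))
  (subst₂ _≤_ (∣∁p∣≡n∸∣p∣ p) (∣∁p∣≡n∸∣p∣ q) le)

x∈p─q⇒x∉q : ∀ {n} {x} (p q : Subset n) → x ∈ p ─ q → x ∉ q
x∈p─q⇒x∉q (_ ∷ p) (outside ∷ q) here        ()
x∈p─q⇒x∉q (_ ∷ p) (inside  ∷ q) ()          here
x∈p─q⇒x∉q (_ ∷ p) (_       ∷ q) (there x∈) (there x∈q) = x∈p─q⇒x∉q p q x∈ x∈q

p⊂p∪⁅x⁆ : ∀ {m} {p : Subset m} {x} → x ∉ p → p ⊂ p ∪ ⁅ x ⁆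
p⊂p∪⁅x⁆ {p = p} {x} x∉p = p⊆p∪q ⁅ x ⁆ , x , q⊆p∪q p ⁅ x ⁆ (x∈⁅x⁆ x) , x∉p

module _ {m : ℕ} {I : Pred (Subset m) 0ℓ} (I? : Decidable I) where

  maximalIndependentIn? : ∀ C → Decidable (MaximalIndependentIn I C)
  maximalIndependentIn? C B = map′ pack unpack
    ((B ⊆? C) ×-dec I? B ×-dec
     all? λ e → (e ∈? C ─ B) →-dec ¬? (I? (B ∪ ⁅ e ⁆)))
    where
    Fields : Set
    Fields = B ⊆ C × I B × (∀ e → e ∈ C ─ B → ¬ I (B ∪ ⁅ e ⁆))
    pack : Fields → MaximalIndependentIn I C B
    pack (w , i , x) = record { within = w ; independent = i ; maximal = x }
    unpack : MaximalIndependentIn I C B → Fields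
    unpack M = let open MaximalIndependentIn M in within , independent , maximal

  -- An independent subset of `C` of largest size is also maximal under inclusion, because adding an
  -- element outside it would increase the size.
  maximalIndependentIn-satisfiable : I ⊥ → ∀ C → Satisfiable (MaximalIndependentIn I C)
  maximalIndependentIn-satisfiable I⊥ C
    with B , (B⊆C , IB) , largest ←
           minimiser (λ B → (B ⊆? C) ×-dec I? B) (⊥ , ⊥⊆ , I⊥) (∣_∣ ∘ ∁)
    = B , record { within = B⊆C ; independent = IB ; maximal = maximal }
    where
    maximal : ∀ e → e ∈ C ─ B → ¬ I (B ∪ ⁅ e ⁆)
    maximal e e∈C─B IB∪e = <⇒≱ (p⊂q⇒∣p∣<∣q∣ (p⊂p∪⁅x⁆ (x∈p─q⇒x∉q C B e∈C─B)))
      (∣∁∣-cancel-≤ B (B ∪ ⁅ e ⁆) (largest (B ∪ ⁅ e ⁆) (B∪e⊆C , IB∪e)))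
      where
      B∪e⊆C : B ∪ ⁅ e ⁆ ⊆ C
      B∪e⊆C x∈ with x∈p∪q⁻ B ⁅ e ⁆ x∈
      ... | inj₁ x∈B = B⊆C x∈B
      ... | inj₂ x∈e with refl ← x∈⁅y⁆⇒x≡y e x∈e = p─q⊆p C B e∈C─B

  -- Decidability ensures that both extremes are attained, so it suffices to compare two arbitrary
  -- maximal independent subsets of `C`.
  isIndependenceSystem : ∀ {p} → I ⊥ → (∀ A B → A ⊆ B → I B → I A) →
    (∀ C A B → MaximalIndependentIn I C A → MaximalIndependentIn I C B → ∣ A ∣ ≤ p * ∣ B ∣) →
    IsIndependenceSystem p I
  isIndependenceSystem {p} I⊥ hereditary ratio = record
    { nonempty   = ⊥ , I⊥
    ; hereditary = λ A B A⊂B → hereditary A B (p⊂q⇒p⊆q A⊂B)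
    ; max≤p*min  = λ C _ → bases C
    }
    where
    bases : ∀ C → ∃₂ λ max min → IsMaxSize (MaximalIndependentIn I C) max ×
                                 IsMinSize (MaximalIndependentIn I C) min × max ≤ p * min
    bases C =
      let exists = maximalIndependentIn-satisfiable I⊥ C
          A , MA , largest  = minimiser (maximalIndependentIn? C) exists (∣_∣ ∘ ∁)
          B , MB , smallest = minimiser (maximalIndependentIn? C) exists ∣_∣
      in ∣ A ∣ , ∣ B ∣ ,
         ((A , MA , refl) , λ A′ MA′ → ∣∁∣-cancel-≤ A A′ (largest A′ MA′)) ,
         ((B , MB , refl) , smallest) ,
         ratio C A B MA MB

-- Degrees

module _ (G : Graph) where
  open Graph G

  incident? : ∀ A v e → Dec (e ∈ A × v ∈ edge e)
  incident? A v e = (e ∈? A) ×-dec (v ∈? edge e)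

  -- Double count of the pairs of a neighbour `w` and an edge of `A` joining `v` to `w`: each `w`
  -- has at most one such edge because edges are listed without repetition, and each edge at `v` has
  -- exactly one other end.
  deg≡∑incident : ∀ A v → deg G A v ≡ ∑[ e < #E ] 𝟙 (incident? A v e)
  deg≡∑incident A v = begin
    deg G A v                               ≡⟨ ∣tabulate∣≡∑𝟙 (joined? G A v) ⟩
    ∑[ w < #V ] 𝟙 (joined? G A v w)
      ≡⟨ sum-cong-≗ (λ w → ∑𝟙-unique (λ e → joins? e w) unique-edge) ⟨
    ∑[ w < #V ] ∑[ e < #E ] 𝟙 (joins? e w)  ≡⟨ ∑-comm (λ w e → 𝟙 (joins? e w)) ⟩
    ∑[ e < #E ] ∑[ w < #V ] 𝟙 (joins? e w)
      ≡⟨ sum-cong-≗ (λ e → ∑𝟙-unique (joins? e) unique-end) ⟩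
    ∑[ e < #E ] 𝟙 (any? (joins? e))
      ≡⟨ sum-cong-≗ (λ e →
        𝟙-cong (any? (joins? e)) (incident? A v e) incident joins) ⟩
    ∑[ e < #E ] 𝟙 (incident? A v e)         ∎
    where
    open ≡-Reasoning
    Joins : Fin #E → Fin #V → Set
    Joins e w = e ∈ A × edge e ≡ ⁅ v ⁆ ∪ ⁅ w ⁆
    joins? : ∀ e w → Dec (Joins e w)
    joins? e w = (e ∈? A) ×-dec ≡-dec _≟ᵇ_ (edge e) (⁅ v ⁆ ∪ ⁅ w ⁆)
    unique-edge : ∀ {w e f} → Joins e w → Joins f w → e ≡ f
    unique-edge (_ , eq) (_ , eq′) = edge-injective (trans eq (sym eq′))
    unique-end : ∀ {e w x} → Joins e w → Joins e x → w ≡ x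
    unique-end {e} (_ , eq) (_ , eq′) = ⁅x⁆∪⁅y⁆-injectiveʳ
      (trans (cong ∣_∣ (sym eq)) (edge-size e)) (trans (sym eq) eq′)
    incident : ∀ {e} → ∃ (Joins e) → e ∈ A × v ∈ edge e
    incident (w , e∈A , eq) = e∈A , subst (v ∈_) (sym eq) (x∈p∪q⁺ (inj₁ (x∈⁅x⁆ v)))
    joins : ∀ {e} → e ∈ A × v ∈ edge e → ∃ (Joins e)
    joins {e} (e∈A , v∈e) =
      let w , eq = ∣p∣≡2⇒p≡⁅x⁆∪⁅y⁆ (edge-size e) v∈e in w , e∈A , eq

  -- Inclusion is asked only of edges at `v`, so that the lemma serves heredity and also the
  -- insertion of an edge that misses `v`.
  deg-mono : ∀ A B v → (∀ {e} → e ∈ A → v ∈ edge e → e ∈ B) → deg G A v ≤ deg G B v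
  deg-mono A B v sub = subst₂ _≤_ (sym (deg≡∑incident A v)) (sym (deg≡∑incident B v))
    (sum-mono-≤ λ e → 𝟙-mono (incident? A v e) (incident? B v e)
                             λ (e∈A , v∈e) → sub e∈A v∈e , v∈e)

  deg-⊥ : ∀ v → deg G ⊥ v ≤ 0
  deg-⊥ v = begin
    deg G ⊥ v                        ≡⟨ deg≡∑incident ⊥ v ⟩
    ∑[ e < #E ] 𝟙 (incident? ⊥ v e)
      ≤⟨ sum-mono-≤ (λ e → 𝟙-mono (incident? ⊥ v e) (e ∈? ⊥) proj₁) ⟩
    ∑[ e < #E ] 𝟙 (e ∈? ⊥)           ≡⟨ ∣p∣≡∑𝟙 (⊥ {#E}) ⟨
    ∣ ⊥ {#E} ∣                       ≡⟨ ∣⊥∣≡0 #E ⟩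
    0                                ∎
    where open ≤-Reasoning

  deg-∪⁅⁆ : ∀ A e v → deg G (A ∪ ⁅ e ⁆) v ≤ suc (deg G A v)
  deg-∪⁅⁆ A e v = begin
    deg G (A ∪ ⁅ e ⁆) v
      ≡⟨ deg≡∑incident (A ∪ ⁅ e ⁆) v ⟩
    ∑[ f < #E ] 𝟙 (incident? (A ∪ ⁅ e ⁆) v f)                           ≤⟨ sum-mono-≤ split ⟩
    ∑[ f < #E ] (𝟙 (f ∈? ⁅ e ⁆) + 𝟙 (incident? A v f))
      ≡⟨ ∑-distrib-+ (λ f → 𝟙 (f ∈? ⁅ e ⁆)) _ ⟩
    ∑[ f < #E ] 𝟙 (f ∈? ⁅ e ⁆) + ∑[ f < #E ] 𝟙 (incident? A v f)
      ≡⟨ cong₂ _+_ (trans (sym (∣p∣≡∑𝟙 ⁅ e ⁆)) (∣⁅x⁆∣≡1 e))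
                    (sym (deg≡∑incident A v)) ⟩
    suc (deg G A v)  ∎
    where
    open ≤-Reasoning
    split : ∀ f → 𝟙 (incident? (A ∪ ⁅ e ⁆) v f) ≤ 𝟙 (f ∈? ⁅ e ⁆) + 𝟙 (incident? A v f)
    split f with f ∈? ⁅ e ⁆
    ... | yes _   = ≤-trans (𝟙≤1 (incident? (A ∪ ⁅ e ⁆) v f)) (s≤s z≤n)
    ... | no  f∉e = 𝟙-mono (incident? (A ∪ ⁅ e ⁆) v f) (incident? A v f) λ (f∈ , v∈f) →
      [ id , (λ f∈e → contradiction f∈e f∉e) ]′ (x∈p∪q⁻ A ⁅ e ⁆ f∈) , v∈f

  -- The total weight of the endpoints of an edge; for the indicator of the saturated vertices it is
  -- the number `s e`.
  load : (Fin #V → ℕ) → Fin #E → ℕ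
  load x e = ∑[ v < #V ] (𝟙 (v ∈? edge e) * x v)

  -- Weighted handshake identity, obtained by counting incidences by vertex and by edge.
  ∑deg≡∑load : ∀ A x → ∑[ v < #V ] (deg G A v * x v) ≡ ∑[ e < #E ] (𝟙 (e ∈? A) * load x e)
  ∑deg≡∑load A x = begin
    ∑[ v < #V ] (deg G A v * x v)
      ≡⟨ sum-cong-≗ (λ v → cong (_* x v) (deg≡∑incident A v)) ⟩
    ∑[ v < #V ] (sum (λ e → 𝟙 (incident? A v e)) * x v)
      ≡⟨ sum-cong-≗ (λ v → *-distribʳ-sum (x v) (λ e → 𝟙 (incident? A v e))) ⟩
    ∑[ v < #V ] ∑[ e < #E ] (𝟙 (incident? A v e) * x v)
      ≡⟨ ∑-comm (λ v e → 𝟙 (incident? A v e) * x v) ⟩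
    ∑[ e < #E ] ∑[ v < #V ] (𝟙 (incident? A v e) * x v)
      ≡⟨ sum-cong-≗ (λ e → sum-cong-≗ (λ v → trans
           (cong (_* x v) (𝟙-× (e ∈? A) (v ∈? edge e)))
           (*-assoc (𝟙 (e ∈? A)) (𝟙 (v ∈? edge e)) (x v)))) ⟩
    ∑[ e < #E ] ∑[ v < #V ] (𝟙 (e ∈? A) * (𝟙 (v ∈? edge e) * x v))
      ≡⟨ sum-cong-≗ (λ e → *-distribˡ-sum (𝟙 (e ∈? A)) (λ v → 𝟙 (v ∈? edge e) * x v)) ⟨
    ∑[ e < #E ] (𝟙 (e ∈? A) * load x e) ∎
    where open ≡-Reasoning

  -- Maximal degree-bounded edge sets

  module _ (d : Fin #V → ℕ) where

    degreeBounded? : Decidable (DegreeBounded G d)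
    degreeBounded? A = all? λ v → deg G A v ≤? d v

    saturated-endpoint : ∀ {C B e} → MaximalIndependentIn (DegreeBounded G d) C B →
                         e ∈ C → e ∉ B → ∃ λ v → v ∈ edge e × d v ≤ deg G B v
    saturated-endpoint {C} {B} {e} MB e∈C e∉B
      -- By maximality, inserting `e` violates the bound at some vertex, and decidability extracts
      -- it.
      with v , deg≰d ← ¬∀⟶∃¬ #V _ (λ v → deg G (B ∪ ⁅ e ⁆) v ≤? d v)
                         (MaximalIndependentIn.maximal MB e (x∈p∧x∉q⇒x∈p─q e∈C e∉B))
      = v
      -- If `e` missed `v`, the degree there would not exceed the one in `B`, which respects the
      -- bound.
      , decidable-stable (v ∈? edge e) (λ v∉e → deg≰d (≤-trans
          (deg-mono (B ∪ ⁅ e ⁆) B v (away v∉e)) (MaximalIndependentIn.independent MB v)))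
      -- The violation reads `d v < deg`, and `e` accounts for at most one unit of that degree, so
      -- `B` alone already reaches `d v`.
      , s≤s⁻¹ (≤-trans (≰⇒> deg≰d) (deg-∪⁅⁆ B e v))
      where
      away : ∀ {v} → v ∉ edge e → ∀ {f} → f ∈ B ∪ ⁅ e ⁆ → v ∈ edge f → f ∈ B
      away v∉e f∈ v∈f with x∈p∪q⁻ B ⁅ e ⁆ f∈
      ... | inj₁ f∈B = f∈B
      ... | inj₂ f∈e with refl ← x∈⁅y⁆⇒x≡y e f∈e = contradiction v∈f v∉e

    ∣independent∣≤2*∣maximal∣ : ∀ {C A B} → A ⊆ C → DegreeBounded G d A →
      MaximalIndependentIn (DegreeBounded G d) C B → ∣ A ∣ ≤ 2 * ∣ B ∣
    ∣independent∣≤2*∣maximal∣ {C} {A} {B} A⊆C IA MB =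
      -- The load of `B` is added to both sides and cancelled at the end, which avoids subtraction
      -- in `ℕ`.
      +-cancelʳ-≤ (sum (λ e → b e * s e)) _ _ (begin
      ∣ A ∣ + sum (λ e → b e * s e)      ≡⟨ cong (_+ sum (λ e → b e * s e)) (∣p∣≡∑𝟙 A) ⟩
      sum a + sum (λ e → b e * s e)      ≡⟨ ∑-distrib-+ a (λ e → b e * s e) ⟨
      sum (λ e → a e + b e * s e)        ≤⟨ sum-mono-≤ exchange ⟩
      sum (λ e → 2 * b e + a e * s e)    ≡⟨ ∑-distrib-+ (λ e → 2 * b e) (λ e → a e * s e) ⟩
      sum (λ e → 2 * b e) + sum (λ e → a e * s e)
        ≡⟨ cong (_+ sum (λ e → a e * s e)) (*-distribˡ-sum 2 b) ⟨
      2 * sum b + sum (λ e → a e * s e)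
        ≡⟨ cong₂ (λ n t → 2 * n + t) (∣p∣≡∑𝟙 B) (∑deg≡∑load A sat) ⟨
      2 * ∣ B ∣ + sum (λ v → deg G A v * sat v)
        ≤⟨ +-monoʳ-≤ (2 * ∣ B ∣) (sum-mono-≤ deg-saturated) ⟩
      2 * ∣ B ∣ + sum (λ v → deg G B v * sat v)
        ≡⟨ cong (2 * ∣ B ∣ +_) (∑deg≡∑load B sat) ⟩
      2 * ∣ B ∣ + sum (λ e → b e * s e)  ∎)
      where
      open ≤-Reasoning
      a b s : Fin #E → ℕ
      sat : Fin #V → ℕ
      a e = 𝟙 (e ∈? A)
      b e = 𝟙 (e ∈? B)
      sat v = 𝟙 (d v ≤? deg G B v)
      s = load sat

      deg-saturated : ∀ v → deg G A v * sat v ≤ deg G B v * sat v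
      deg-saturated v = helper (d v ≤? deg G B v)
        where
        -- Abstracting the decision lets both indicators reduce together; in the unsaturated case
        -- both products are zero.
        helper : (D : Dec (d v ≤ deg G B v)) → deg G A v * 𝟙 D ≤ deg G B v * 𝟙 D
        helper (yes d≤) = *-monoˡ-≤ 1 (≤-trans (IA v) d≤)
        helper (no _)   = ≤-reflexive (trans (*-zeroʳ (deg G A v)) (sym (*-zeroʳ (deg G B v))))

      s≤2 : ∀ e → s e ≤ 2
      s≤2 e = begin
        s e
          ≤⟨ sum-mono-≤ (λ v → *-monoʳ-≤ (𝟙 (v ∈? edge e)) (𝟙≤1 (d v ≤? deg G B v))) ⟩
        sum (λ v → 𝟙 (v ∈? edge e) * 1) ≡⟨ sum-cong-≗ (λ v → *-identityʳ (𝟙 (v ∈? edge e))) ⟩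
        sum (λ v → 𝟙 (v ∈? edge e))     ≡⟨ ∣p∣≡∑𝟙 (edge e) ⟨
        ∣ edge e ∣                      ≡⟨ edge-size e ⟩
        2                               ∎

      1≤s : ∀ {e} → e ∈ A → e ∉ B → 1 ≤ s e
      1≤s {e} e∈A e∉B with v , v∈e , d≤ ← saturated-endpoint MB (A⊆C e∈A) e∉B = begin
        1
          ≡⟨ cong₂ _*_ (𝟙-true (v ∈? edge e) v∈e) (𝟙-true (d v ≤? deg G B v) d≤) ⟨
        𝟙 (v ∈? edge e) * sat v  ≤⟨ term≤sum (λ v → 𝟙 (v ∈? edge e) * sat v) v ⟩
        s e                      ∎

      -- The four cases amount to `1 + s ≤ 2 + s` on both sets, `1 ≤ s` on `A` only, `s ≤ 2` on `B`
      -- only, and `0 ≤ 0` elsewhere.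
      exchange : ∀ e → a e + b e * s e ≤ 2 * b e + a e * s e
      exchange e with e ∈? A | e ∈? B
      ... | yes _   | yes _   = n≤1+n _
      ... | yes e∈A | no  e∉B = ≤-trans (1≤s e∈A e∉B) (m≤m+n (s e) 0)
      ... | no  _   | yes _   = ≤-trans (≤-reflexive (+-identityʳ (s e))) (s≤2 e)
      ... | no  _   | no  _   = z≤n

theorem10 : (G : Graph) (d : Fin (Graph.#V G) → ℕ) →
    IsIndependenceSystem 2 (DegreeBounded G d)
theorem10 G d = isIndependenceSystem (degreeBounded? G d)
  (λ v → ≤-trans (deg-⊥ G v) z≤n)
  (λ A B A⊆B IB v → ≤-trans (deg-mono G A B v (λ e∈A _ → A⊆B e∈A)) (IB v))
  (λ C A B MA MB → let open MaximalIndependentIn MA in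
    ∣independent∣≤2*∣maximal∣ G d within independent MB)
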